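{- For all natural numbers $m$ and $n$, every vertex of the polytope $\operatorname{Hom}(\Box_m,\triangle_n)$ has rank $0$ or $1$; that is, $$\operatorname{vert}(\Box_m,\triangle_n)=\operatorname{vert}^{(0)}(\Box_m,\triangle_n)\cup\operatorname{vert}^{(1)}(\Box_m,\triangle_n).$$
   Context: For convex polytopes $P,Q$ (in real finite-dimensional vector spaces), $\operatorname{Hom}(P,Q)$ denotes the set of maps $P\to Q$ that are restrictions of affine maps $\operatorname{Aff}(P)\to\operatorname{Aff}(Q)$ between the affine hulls; viewed as a subset of the real affine space of all affine maps $\operatorname{Aff}(P)\to\operatorname{Aff}(Q)$, it is a convex polytope. $\operatorname{vert}(P,Q)$ denotes its set of vertices (called vertex maps). The rank of $f\in\operatorname{Hom}(P,Q)$ is $\dim\operatorname{Aff}(f(P))$, and $\operatorname{vert}^{(k)}(P,Q)$ is the set of vertex maps of rank $k$. $\triangle_n=\operatorname{conv}(0,e_1,\ldots,e_n)\subset\mathbb{R}^n$ and $\Box_m=\operatorname{conv}\{(a_1,\ldots,a_m): a_i=\pm1\}\subset\mathbb{R}^m$, where $e_i$ are standard basis vectors. -}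

module Defs where

open import Algebra.Apartness.Bundles using (HeytingField; HeytingCommutativeRing)
open import Algebra.Bundles using (CommutativeRing; Semiring)
import Algebra.Definitions.RawSemiring as RawSemiringDefinitions
open import Data.Bool.Base using (if_then_else_)
open import Data.Fin.Base using (Fin)
open import Data.Fin.Properties using (_≟_)
open import Data.Nat.Base as ℕ using (ℕ)
open import Data.Product.Base using (Σ; ∃; ∃₂; _×_; _,_; proj₁; proj₂)
open import Data.Sum.Base using (_⊎_)
open import Data.Vec.Functional using (Vector)
import Data.Vec.Functional.Relation.Binary.Equality.Setoid as VectorEquality
open import Function.Bundles using (_⇔_)
open import Level using (Level; _⊔_; suc)
open import Relation.Binary.Core using (Rel)
open import Relation.Binary.Structures using (IsStrictPartialOrder)
open import Relation.Nullary.Decidable.Core using (does)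
open import Relation.Nullary.Negation.Core using (¬_)
open import Relation.Unary using (Pred; _∈_; _∩_)

-- The real numbers, given axiomatically as a Cauchy-complete Archimedean
-- ordered field.  Classically these axioms determine ℝ up to isomorphism.
-- Neither decidability nor trichotomy of the order is assumed, so that the
-- axioms are also those satisfied by the constructive reals.
record Reals (c ℓ₁ ℓ₂ : Level) : Set (suc (c ⊔ ℓ₁ ⊔ ℓ₂)) where
  field
    heytingField : HeytingField c ℓ₁ ℓ₂

  open HeytingField heytingField public

  commutativeRing : CommutativeRing c ℓ₁
  commutativeRing = HeytingCommutativeRing.commutativeRing heytingCommutativeRing

  open RawSemiringDefinitions (Semiring.rawSemiring (CommutativeRing.semiring commutativeRing)) public
    using (sum) renaming (_×_ to _⋆_)

  infix 4 _<_ _≤_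

  field
    _<_                  : Rel Carrier ℓ₂
    isStrictPartialOrder : IsStrictPartialOrder _≈_ _<_
    #⇔<⊎>                : ∀ {x y} → x # y ⇔ (x < y ⊎ y < x)
    +-monoˡ-<            : ∀ z {x y} → x < y → x + z < y + z
    *-pos                : ∀ {x y} → 0# < x → 0# < y → 0# < x * y
    archimedean          : ∀ x → ∃ λ n → x < n ⋆ 1#

  _≤_ : Rel Carrier ℓ₂
  x ≤ y = ¬ (y < x)

  -- The bound is imposed on both s m - s n and s n - s m, as m and n range
  -- over the same set; this is |s m - s n| < ε.
  Cauchy : (ℕ → Carrier) → Set (c ⊔ ℓ₂)
  Cauchy s = ∀ ε → 0# < ε → ∃ λ N → ∀ m n → N ℕ.≤ m → N ℕ.≤ n → s m - s n < ε

  _ConvergesTo_ : (ℕ → Carrier) → Carrier → Set (c ⊔ ℓ₂)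
  s ConvergesTo l =
    ∀ ε → 0# < ε → ∃ λ N → ∀ n → N ℕ.≤ n → (s n - l < ε) × (l - s n < ε)

  field
    complete : ∀ s → Cauchy s → ∃ λ l → s ConvergesTo l


module Polytopes {c ℓ₁ ℓ₂} (ℝ : Reals c ℓ₁ ℓ₂) where

  open Reals ℝ
  open VectorEquality (CommutativeRing.setoid commutativeRing) public using (_≋_)

  infixl 6 _⊕_
  infixr 7 _·_

  ℝ^_ : ℕ → Set c
  ℝ^ d = Vector Carrier d

  𝟎 : ∀ {d} → ℝ^ d
  𝟎 _ = 0#

  e : ∀ {d} → Fin d → ℝ^ d
  e i j = if does (i ≟ j) then 1# else 0#

  _⊕_ : ∀ {d} → ℝ^ d → ℝ^ d → ℝ^ d
  (x ⊕ y) i = x i + y i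

  _⊖_ : ∀ {d} → ℝ^ d → ℝ^ d → ℝ^ d
  (x ⊖ y) i = x i - y i

  _·_ : ∀ {d} → Carrier → ℝ^ d → ℝ^ d
  (t · x) i = t * x i

  lincomb : ∀ {k d} → (Fin k → Carrier) → (Fin k → ℝ^ d) → ℝ^ d
  lincomb w p i = sum (λ j → w j * p j i)

  Subset : ℕ → (s : Level) → Set (c ⊔ suc s)
  Subset d s = Pred (ℝ^ d) s

  Point : ∀ {d s} → Subset d s → Set (c ⊔ s)
  Point A = ∃ λ x → x ∈ A

  Aff : ∀ {d s} → Subset d s → Subset d (c ⊔ ℓ₁ ⊔ s)
  Aff {d} S x = ∃ λ k → Σ (Fin k → Carrier) λ w → Σ (Fin k → ℝ^ d) λ p →
    (∀ j → p j ∈ S) × sum w ≈ 1# × x ≋ lincomb w p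

  Conv : ∀ {d s} → Subset d s → Subset d (c ⊔ ℓ₁ ⊔ ℓ₂ ⊔ s)
  Conv {d} S x = ∃ λ k → Σ (Fin k → Carrier) λ w → Σ (Fin k → ℝ^ d) λ p →
    (∀ j → p j ∈ S) × (∀ j → 0# ≤ w j) × sum w ≈ 1# × x ≋ lincomb w p

  □ : ∀ m → Subset m (c ⊔ ℓ₁ ⊔ ℓ₂)
  □ m = Conv λ a → ∀ i → a i ≈ 1# ⊎ a i ≈ - 1#

  △ : ∀ n → Subset n (c ⊔ ℓ₁ ⊔ ℓ₂)
  △ n = Conv λ x → x ≋ 𝟎 ⊎ ∃ λ i → x ≋ e i

  -- Dimension of an affine subspace A: the dimension of its space of
  -- directions { x - y ∣ x , y ∈ A }, witnessed by a basis.

  Direction : ∀ {d s} → Subset d s → Subset d (c ⊔ ℓ₁ ⊔ s)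
  Direction A v = ∃₂ λ x y → x ∈ A × y ∈ A × v ≋ (x ⊖ y)

  LinearlyIndependent : ∀ {k d} → (Fin k → ℝ^ d) → Set (c ⊔ ℓ₁)
  LinearlyIndependent b = ∀ w → lincomb w b ≋ 𝟎 → ∀ j → w j ≈ 0#

  HasDimension : ∀ {d s} → Subset d s → ℕ → Set (c ⊔ ℓ₁ ⊔ s)
  HasDimension {d} A k = Point A × Σ (Fin k → ℝ^ d) λ b →
    (∀ j → b j ∈ Direction A) ×
    LinearlyIndependent b ×
    (∀ v → v ∈ Direction A → ∃ λ w → v ≋ lincomb w b)

  -- Maps preserving all finite affine combinations.  The case k = 1 makes
  -- them respect ≋, so they do not depend on the membership proofs.
  record AffineMap {d d′ s s′} (A : Subset d s) (B : Subset d′ s′)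
    : Set (c ⊔ ℓ₁ ⊔ s ⊔ s′) where
    field
      to : Point A → Point B

    infixl 9 _⟨_⟩
    _⟨_⟩ : Point A → ℝ^ d′
    _⟨_⟩ x = proj₁ (to x)

    field
      affine : ∀ {k} (w : Fin k → Carrier) (p : Fin k → Point A) (x : Point A) →
               sum w ≈ 1# →
               proj₁ x ≋ lincomb w (λ j → proj₁ (p j)) →
               _⟨_⟩ x ≋ lincomb w (λ j → _⟨_⟩ (p j))

  open AffineMap public using (_⟨_⟩)

  module _ {d d′ s s′} (P : Subset d s) (Q : Subset d′ s′) where

    -- A map P → Q that is the restriction of an affine map Aff P → Aff Q is
    -- represented by that (uniquely determined) affine map.
    Hom : Pred (AffineMap (Aff P) (Aff Q)) (c ⊔ ℓ₁ ⊔ s ⊔ s′)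
    Hom f = ∀ x → proj₁ x ∈ P → f ⟨ x ⟩ ∈ Q

    -- Extreme points of Hom(P,Q) in the affine space of affine maps
    -- Aff P → Aff Q, whose equality and affine structure are pointwise.
    vert : Pred (AffineMap (Aff P) (Aff Q)) (c ⊔ ℓ₁ ⊔ ℓ₂ ⊔ s ⊔ s′)
    vert f = f ∈ Hom ×
      (∀ g h t → g ∈ Hom → h ∈ Hom → 0# < t → t < 1# →
        (∀ x → f ⟨ x ⟩ ≋ (1# - t) · g ⟨ x ⟩ ⊕ t · h ⟨ x ⟩) →
        ∀ x → g ⟨ x ⟩ ≋ h ⟨ x ⟩)

    Image : AffineMap (Aff P) (Aff Q) → Subset d′ (c ⊔ ℓ₁ ⊔ s)
    Image f y = ∃ λ x → proj₁ x ∈ P × y ≋ f ⟨ x ⟩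

    HasRank : ℕ → Pred (AffineMap (Aff P) (Aff Q)) (c ⊔ ℓ₁ ⊔ s)
    HasRank k f = HasDimension (Aff (Image f)) k

    vert⁽_⁾ : ℕ → Pred (AffineMap (Aff P) (Aff Q)) (c ⊔ ℓ₁ ⊔ ℓ₂ ⊔ s ⊔ s′)
    vert⁽ k ⁾ = vert ∩ HasRank k

{-# OPTIONS --safe #-}

-- Write the barycentric coordinates of a vertex f as affine functions ψ₀,…,ψₙ on
-- the cube, and let v be the corner (-1,…,-1) and ψⱼ a coordinate with ψⱼ(v) > 0.
-- Either ψⱼ is bounded below by some δ > 0 on all corners, or it decreases along
-- some edge of the cube at v, say in direction i; in the latter case another
-- coordinate ψₖ increases along that edge.  Let g be the constant map to the j-th
-- vertex of the simplex in the first case, and in the second case the map which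
-- depends on xᵢ only and takes the edge of the cube to the edge from the j-th to
-- the k-th vertex of the simplex.  Then the barycentric coordinates of f dominate
-- a positive multiple of those of g, so f is a proper convex combination of g and
-- another element of Hom, and extremality forces f = g.

module Submission where

open import Defs
open import Algebra.Bundles using (CommutativeRing; RawRing)
import Algebra.Apartness.Properties.HeytingCommutativeRing
import Algebra.Properties.CommutativeSemigroup
import Algebra.Properties.Ring
import Algebra.Properties.Semiring.Mult.TCOptimised
import Algebra.Properties.Semiring.Sum
import Algebra.Solver.Ring
open import Algebra.Solver.Ring.AlmostCommutativeRing
  using (fromCommutativeRing; _-Raw-AlmostCommutative⟶_)
open import Data.Fin.Base using (Fin; zero; suc)
open import Data.Fin.Properties using (_≟_)
open import Data.Maybe.Base as Maybe using (Maybe)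
open import Data.Nat.Base as ℕ using (ℕ; zero; suc)
import Data.Nat.Properties as ℕ
open import Data.Product.Base using (∃; ∃₂; _×_; _,_; proj₁; proj₂)
open import Data.Product.Properties using (≡-dec)
open import Data.Sum.Base as Sum using (_⊎_; inj₁; inj₂; [_,_]′)
open import Data.Vec.Functional using ([]; _∷_)
open import Function.Base using (_∘_)
open import Function.Bundles using (module Equivalence)
open import Level using (Level)
open import Relation.Binary.PropositionalEquality.Core as ≡ using (_≡_; _≢_)
open import Relation.Binary.Structures using (IsStrictPartialOrder)
open import Relation.Nullary.Decidable.Core using (yes; no; dec⇒maybe)
open import Relation.Nullary.Negation.Core using (contradiction)
open import Relation.Unary using (_∈_; _⊆_; _≐_; _∪_)

-- Solving identities in commutative rings.

-- Formal differences of natural numbers serve as coefficients, so that the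
-- solver cancels x - x although equality in the ring is undecidable.
module RingSolver {c ℓ} (R : CommutativeRing c ℓ) where
  open CommutativeRing R hiding (zero)
  open Algebra.Properties.Ring ring
  open Algebra.Properties.Semiring.Mult.TCOptimised semiring renaming (_×_ to _⋆_)
  open Algebra.Properties.CommutativeSemigroup +-commutativeSemigroup using (interchange)
  open import Relation.Binary.Reasoning.Setoid setoid

  private
    -- The solver compares coefficients syntactically, so they are kept reduced.
    reduce : ℕ → ℕ → ℕ × ℕ
    reduce (suc a) (suc b) = reduce a b
    reduce a       b       = a , b

    differences : RawRing _ _
    differences = record
      { Carrier = ℕ × ℕ
      ; _≈_     = _≡_
      ; _+_     = λ { (a , b) (c , d) → reduce (a ℕ.+ c) (b ℕ.+ d) }
      ; _*_     = λ { (a , b) (c , d) → reduce (a ℕ.* c ℕ.+ b ℕ.* d) (a ℕ.* d ℕ.+ b ℕ.* c) }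
      ; -_      = λ { (a , b) → b , a }
      ; 0#      = 0 , 0
      ; 1#      = 1 , 0
      }

    -- The first clause makes the numerals 0 and 1 evaluate to 0# and 1# on the nose.
    ⟦_⟧ : ℕ × ℕ → Carrier
    ⟦ a , zero  ⟧ = a ⋆ 1#
    ⟦ a , suc b ⟧ = a ⋆ 1# - suc b ⋆ 1#

    -- Removes the case split in `⟦_⟧`, so that the homomorphism laws can be checked on plain
    -- differences.
    ⟦⟧-sub : ∀ a b → ⟦ a , b ⟧ ≈ a ⋆ 1# - b ⋆ 1#
    ⟦⟧-sub a zero    = sym (trans (+-congˡ -0#≈0#) (+-identityʳ _))
    ⟦⟧-sub a (suc b) = refl

    sub-+ : ∀ x y z w → (x + z) - (y + w) ≈ (x - y) + (z - w)
    sub-+ x y z w = trans (+-congˡ (sym (-‿+-comm y w))) (interchange x z (- y) (- w))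

    sub-* : ∀ x y z w → (x * z + y * w) - (x * w + y * z) ≈ (x - y) * (z - w)
    sub-* x y z w = begin
      (x * z + y * w) - (x * w + y * z)   ≈⟨ sub-+ _ _ _ _ ⟩
      (x * z - x * w) + (y * w - y * z)   ≈⟨ +-congˡ (⁻¹-anti-homo‿- _ _) ⟨
      (x * z - x * w) - (y * z - y * w)   ≈⟨ +-cong (x[y-z]≈xy-xz _ _ _) (-‿cong (x[y-z]≈xy-xz _ _ _)) ⟨
      x * (z - w) - y * (z - w)           ≈⟨ [y-z]x≈yx-zx _ _ _ ⟨
      (x - y) * (z - w)                   ∎

    homo-+ : ∀ a b → (a ℕ.+ b) ⋆ 1# ≈ a ⋆ 1# + b ⋆ 1#
    homo-+ = ×-homo-+ 1#

    homo-+* : ∀ a b c d → (a ℕ.* b ℕ.+ c ℕ.* d) ⋆ 1# ≈ (a ⋆ 1#) * (b ⋆ 1#) + (c ⋆ 1#) * (d ⋆ 1#)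
    homo-+* a b c d = trans (homo-+ (a ℕ.* b) (c ℕ.* d)) (+-cong (×1-homo-* a b) (×1-homo-* c d))

    -- Each round of `reduce` drops a summand `1# - 1#`, which vanishes.
    ⟦reduce⟧-sub : ∀ a b → ⟦ reduce a b ⟧ ≈ a ⋆ 1# - b ⋆ 1#
    ⟦reduce⟧-sub zero    b       = ⟦⟧-sub zero b
    ⟦reduce⟧-sub (suc a) zero    = ⟦⟧-sub (suc a) zero
    ⟦reduce⟧-sub (suc a) (suc b) = begin
      ⟦ reduce a b ⟧                    ≈⟨ ⟦reduce⟧-sub a b ⟩
      a ⋆ 1# - b ⋆ 1#                   ≈⟨ trans (+-congʳ (-‿inverseʳ 1#)) (+-identityˡ _) ⟨
      (1# - 1#) + (a ⋆ 1# - b ⋆ 1#)     ≈⟨ sub-+ _ _ _ _ ⟨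
      (1# + a ⋆ 1#) - (1# + b ⋆ 1#)     ≈⟨ +-cong (homo-+ 1 a) (-‿cong (homo-+ 1 b)) ⟨
      suc a ⋆ 1# - suc b ⋆ 1#           ∎

    homomorphism : differences -Raw-AlmostCommutative⟶ fromCommutativeRing R
    homomorphism = record
      { ⟦_⟧    = ⟦_⟧
      ; +-homo = λ { (a , b) (c , d) → begin
          ⟦ reduce (a ℕ.+ c) (b ℕ.+ d) ⟧          ≈⟨ ⟦reduce⟧-sub (a ℕ.+ c) (b ℕ.+ d) ⟩
          (a ℕ.+ c) ⋆ 1# - (b ℕ.+ d) ⋆ 1#         ≈⟨ +-cong (homo-+ a c) (-‿cong (homo-+ b d)) ⟩
          (a ⋆ 1# + c ⋆ 1#) - (b ⋆ 1# + d ⋆ 1#)   ≈⟨ sub-+ _ _ _ _ ⟩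
          (a ⋆ 1# - b ⋆ 1#) + (c ⋆ 1# - d ⋆ 1#)   ≈⟨ +-cong (⟦⟧-sub a b) (⟦⟧-sub c d) ⟨
          ⟦ a , b ⟧ + ⟦ c , d ⟧                   ∎ }
      ; *-homo = λ { (a , b) (c , d) → begin
          ⟦ reduce (a ℕ.* c ℕ.+ b ℕ.* d) (a ℕ.* d ℕ.+ b ℕ.* c) ⟧
            ≈⟨ ⟦reduce⟧-sub (a ℕ.* c ℕ.+ b ℕ.* d) (a ℕ.* d ℕ.+ b ℕ.* c) ⟩
          (a ℕ.* c ℕ.+ b ℕ.* d) ⋆ 1# - (a ℕ.* d ℕ.+ b ℕ.* c) ⋆ 1#
            ≈⟨ +-cong (homo-+* a c b d) (-‿cong (homo-+* a d b c)) ⟩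
          ((a ⋆ 1#) * (c ⋆ 1#) + (b ⋆ 1#) * (d ⋆ 1#)) - ((a ⋆ 1#) * (d ⋆ 1#) + (b ⋆ 1#) * (c ⋆ 1#))
            ≈⟨ sub-* _ _ _ _ ⟩
          (a ⋆ 1# - b ⋆ 1#) * (c ⋆ 1# - d ⋆ 1#)
            ≈⟨ *-cong (⟦⟧-sub a b) (⟦⟧-sub c d) ⟨
          ⟦ a , b ⟧ * ⟦ c , d ⟧ ∎ }
      ; -‿homo = λ { (a , b) → begin
          ⟦ b , a ⟧             ≈⟨ ⟦⟧-sub b a ⟩
          b ⋆ 1# - a ⋆ 1#       ≈⟨ ⁻¹-anti-homo‿- _ _ ⟨
          - (a ⋆ 1# - b ⋆ 1#)   ≈⟨ -‿cong (⟦⟧-sub a b) ⟨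
          - ⟦ a , b ⟧           ∎ }
      ; 0-homo = refl
      ; 1-homo = refl
      }

    _coeff≟_ : ∀ p q → Maybe (⟦ p ⟧ ≈ ⟦ q ⟧)
    p coeff≟ q = Maybe.map (λ p≡q → reflexive (≡.cong ⟦_⟧ p≡q)) (dec⇒maybe (≡-dec ℕ._≟_ ℕ._≟_ p q))

  open Algebra.Solver.Ring differences (fromCommutativeRing R) homomorphism _coeff≟_ public
    using (Polynomial; solve; con; _:+_; _:*_; _:-_; :-_; _:=_)

  :0 :1 : ∀ {n} → Polynomial n
  :0 = con (0 , 0)
  :1 = con (1 , 0)

-- The strict order of the reals, without trichotomy.

module OrderedField {c ℓ₁ ℓ₂} (ℝ : Reals c ℓ₁ ℓ₂) where
  open Reals ℝ hiding (zero)
  open Algebra.Apartness.Properties.HeytingCommutativeRing heytingCommutativeRing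
    using (1#0; invertibleˡ⇒#; x-0≈x)
  open IsStrictPartialOrder isStrictPartialOrder public using (<-respˡ-≈; <-respʳ-≈)
    renaming (irrefl to <-irrefl; trans to <-trans; asym to <-asym)
  open RingSolver commutativeRing

  private variable
    x y z u v : Carrier

  -- This takes the place of trichotomy. It comes from cotransitivity of apartness: if `z` turns out
  -- to lie on the far side of `x` or `y`, transitivity yields the other alternative.
  <-cotrans : x < y → ∀ z → x < z ⊎ z < y
  <-cotrans x<y z with #-cotrans (Equivalence.from #⇔<⊎> (inj₁ x<y)) z
  ... | inj₁ x#z = [ inj₁ , (λ z<x → inj₂ (<-trans z<x x<y)) ]′ (Equivalence.to #⇔<⊎> x#z)
  ... | inj₂ z#y = [ inj₂ , (λ y<z → inj₁ (<-trans x<y y<z)) ]′ (Equivalence.to #⇔<⊎> z#y)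

  +-monoʳ-< : ∀ z → x < y → z + x < z + y
  +-monoʳ-< z x<y = <-respˡ-≈ (+-comm _ z) (<-respʳ-≈ (+-comm _ z) (+-monoˡ-< z x<y))

  +-cancelʳ-< : ∀ z → x + z < y + z → x < y
  +-cancelʳ-< z lt = <-respˡ-≈ (cancel _ z) (<-respʳ-≈ (cancel _ z) (+-monoˡ-< (- z) lt))
    where
    cancel : ∀ x z → x + z - z ≈ x
    cancel = solve 2 (λ x z → x :+ z :- z := x) refl

  +-cancelˡ-< : ∀ z → z + x < z + y → x < y
  +-cancelˡ-< z lt = +-cancelʳ-< z (<-respˡ-≈ (+-comm z _) (<-respʳ-≈ (+-comm z _) lt))

  x<y⇒0<y-x : x < y → 0# < y - x
  x<y⇒0<y-x {x} x<y = <-respˡ-≈ (-‿inverseʳ x) (+-monoˡ-< (- x) x<y)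

  x<0⇒0<-x : x < 0# → 0# < - x
  x<0⇒0<-x x<0 = <-respʳ-≈ (+-identityˡ _) (x<y⇒0<y-x x<0)

  0<1 : 0# < 1#
  0<1 with Equivalence.to #⇔<⊎> 1#0
  ... | inj₂ 0<1 = 0<1
  ... | inj₁ 1<0 = <-respʳ-≈ (solve 0 (:- :1 :* :- :1 := :1) refl) (*-pos 0<-1 0<-1)
    where 0<-1 = x<0⇒0<-x 1<0

  -- The inverse `r` is apart from 0 because `x` inverts it in turn. It cannot be negative, since
  -- then `x * - r`, which is `- 1#`, would be positive.
  positive⇒invertible : 0# < x → ∃ λ r → x * r ≈ 1# × 0# < r
  positive⇒invertible {x} 0<x = r , x*r≈1 , [ r<0-absurd , (λ 0<r → 0<r) ]′ (Equivalence.to #⇔<⊎> r#0)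
    where
    inverse = #⇒invertible (Equivalence.from #⇔<⊎> (inj₂ 0<x))
    r = proj₁ inverse

    x*r≈1 : x * r ≈ 1#
    x*r≈1 = trans (*-congʳ (sym (x-0≈x x))) (proj₂ (proj₂ inverse))

    r#0 : r # 0#
    r#0 = invertibleˡ⇒# (x , trans (*-congˡ (x-0≈x r)) x*r≈1)

    r<0-absurd : r < 0# → 0# < r
    r<0-absurd r<0 = contradiction 1<0 (<-asym 0<1)
      where
      x*-r≈-1 : x * - r ≈ - 1#
      x*-r≈-1 = trans (solve 2 (λ x r → x :* :- r := :- (x :* r)) refl x r) (-‿cong x*r≈1)

      1<0 : 1# < 0#
      1<0 = <-respˡ-≈ (+-identityˡ 1#) (<-respʳ-≈ (-‿inverseˡ 1#)
              (+-monoˡ-< 1# (<-respʳ-≈ x*-r≈-1 (*-pos 0<x (x<0⇒0<-x r<0)))))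

  -- Abstract because with-abstraction would otherwise normalise the inverse of 2.
  abstract
    half : ∃ λ ½ → 0# < ½ × ½ + ½ ≈ 1#
    half =
      let 0<2 = <-trans 0<1 (<-respˡ-≈ (+-identityʳ 1#) (+-monoʳ-< 1# 0<1))
          ½ , 2*½≈1 , 0<½ = positive⇒invertible 0<2
      in ½ , 0<½ , trans (solve 1 (λ h → h :+ h := (:1 :+ :1) :* h) refl ½) 2*½≈1

  positive-below₁ : 0# < x → ∃ λ z → 0# < z × z < x
  positive-below₁ {x} 0<x with half
  ... | ½ , 0<½ , ½+½≈1 =
    ½ * x , 0<½x , <-respˡ-≈ (+-identityʳ _) (<-respʳ-≈ double (+-monoʳ-< (½ * x) 0<½x))
    where
    0<½x = *-pos 0<½ 0<x

    double : ½ * x + ½ * x ≈ x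
    double = trans (sym (distribʳ x ½ ½)) (trans (*-congʳ ½+½≈1) (*-identityˡ x))

  -- A substitute for the minimum of x and y, which is not at hand constructively.
  positive-below₂ : 0# < x → 0# < y → ∃ λ z → 0# < z × z < x × z < y
  positive-below₂ {x} {y} 0<x 0<y with positive-below₁ 0<x | positive-below₁ 0<y
  ... | a , 0<a , a<x | b , 0<b , b<y with <-cotrans a<x y
  ...   | inj₁ a<y = a , 0<a , a<x , a<y
  ...   | inj₂ y<x = b , 0<b , <-trans b<y y<x , b<y

  -- The weak order, as the negation of the reversed strict order.

  <⇒≤ : x < y → x ≤ y
  <⇒≤ = <-asym

  ≤-respˡ-≈ : x ≈ y → x ≤ z → y ≤ z
  ≤-respˡ-≈ x≈y x≤z z<y = x≤z (<-respʳ-≈ (sym x≈y) z<y)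

  ≤-respʳ-≈ : x ≈ y → z ≤ x → z ≤ y
  ≤-respʳ-≈ x≈y z≤x y<z = z≤x (<-respˡ-≈ (sym x≈y) y<z)

  ≤-reflexive : x ≈ y → x ≤ y
  ≤-reflexive x≈y = <-irrefl (sym x≈y)

  ≤-refl : x ≤ x
  ≤-refl = ≤-reflexive refl

  ≤-trans : x ≤ y → y ≤ z → x ≤ z
  ≤-trans {y = y} x≤y y≤z z<x = [ y≤z , x≤y ]′ (<-cotrans z<x y)

  -- Comparing a supposed reverse inequality with `y + u` isolates the summand responsible for it.
  +-mono-≤ : x ≤ y → u ≤ v → x + u ≤ y + v
  +-mono-≤ {x} {y} {u} {v} x≤y u≤v y+v<x+u with <-cotrans y+v<x+u (y + u)
  ... | inj₁ lt = u≤v (+-cancelˡ-< y lt)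
  ... | inj₂ lt = x≤y (+-cancelʳ-< u lt)

  x≤y⇒0≤y-x : x ≤ y → 0# ≤ y - x
  x≤y⇒0≤y-x {x} {y} x≤y y-x<0 =
    x≤y (<-respˡ-≈ (solve 2 (λ x y → y :- x :+ x := y) refl x y)
      (<-respʳ-≈ (+-identityˡ x) (+-monoˡ-< x y-x<0)))

  x+p≈y⇒x≤y : ∀ {p} → 0# ≤ p → x + p ≈ y → x ≤ y
  x+p≈y⇒x≤y 0≤p x+p≈y = ≤-respˡ-≈ (+-identityʳ _) (≤-respʳ-≈ x+p≈y (+-mono-≤ ≤-refl 0≤p))

  -- A negative product would be invertible, and with it both factors. Being nonnegative and apart
  -- from 0, the factors would be positive, and so would their product.
  *-nonneg : 0# ≤ x → 0# ≤ y → 0# ≤ x * y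
  *-nonneg {x} {y} 0≤x 0≤y xy<0 = <-asym xy<0 (*-pos (positive 0≤x x#0) (positive 0≤y y#0))
    where
    inverse = #⇒invertible (Equivalence.from #⇔<⊎> (inj₁ xy<0))
    r = proj₁ inverse

    r*xy≈1 : r * (x * y) ≈ 1#
    r*xy≈1 = trans (*-congˡ (sym (x-0≈x (x * y)))) (proj₁ (proj₂ inverse))

    x#0 : x # 0#
    x#0 = invertibleˡ⇒# (r * y ,
      trans (solve 3 (λ r x y → r :* y :* (x :- :0) := r :* (x :* y)) refl r x y) r*xy≈1)

    y#0 : y # 0#
    y#0 = invertibleˡ⇒# (r * x ,
      trans (solve 3 (λ r x y → r :* x :* (y :- :0) := r :* (x :* y)) refl r x y) r*xy≈1)

    positive : ∀ {z} → 0# ≤ z → z # 0# → 0# < z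
    positive 0≤z z#0 = [ (λ z<0 → contradiction z<0 0≤z) , (λ 0<z → 0<z) ]′ (Equivalence.to #⇔<⊎> z#0)

  sum-nonneg : ∀ {k} {w : Fin k → Carrier} → (∀ i → 0# ≤ w i) → 0# ≤ sum w
  sum-nonneg {zero}  0≤w = ≤-refl
  sum-nonneg {suc k} 0≤w = ≤-respˡ-≈ (+-identityʳ 0#) (+-mono-≤ (0≤w zero) (sum-nonneg (0≤w ∘ suc)))

  -- The index is found by comparison with the mixed sum of `w′ zero` and the tail of `w`, which
  -- differs from one side only in the head and from the other only in the tail.
  sum-<⇒∃< : ∀ {k} {w w′ : Fin k → Carrier} → sum w < sum w′ → ∃ λ i → w i < w′ i
  sum-<⇒∃< {zero}           lt = contradiction lt (<-irrefl refl)
  sum-<⇒∃< {suc k} {w} {w′} lt with <-cotrans lt (w′ zero + sum (w ∘ suc))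
  ... | inj₁ lt₀ = zero , +-cancelʳ-< _ lt₀
  ... | inj₂ lt₁ = let i , wᵢ<w′ᵢ = sum-<⇒∃< (+-cancelˡ-< _ lt₁) in suc i , wᵢ<w′ᵢ

  -- A number c strictly between 0 and s separates the alternatives a₀ < 0 and c - s < a₀.
  some-negative⊎bounded-below :
    ∀ {k} {s} (a : Fin k → Carrier) → 0# < s →
    (∃ λ i → a i < 0#) ⊎
    (∃ λ δ → 0# < δ ×
      (∀ (y : Fin k → Carrier) → (∀ i → y i ≈ 0# ⊎ y i ≈ 1#) → δ ≤ s + sum (λ i → y i * a i)))
  some-negative⊎bounded-below {zero}  {s} a 0<s =
    inj₂ (s , 0<s , λ _ _ → ≤-reflexive (sym (+-identityʳ s)))
  some-negative⊎bounded-below {suc k} {s} a 0<s with positive-below₁ 0<s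
  ... | c , 0<c , c<s with <-cotrans c-s<0 (a zero)
    where
    c-s<0 : c - s < 0#
    c-s<0 = <-respʳ-≈ (-‿inverseʳ s) (+-monoˡ-< (- s) c<s)
  ...   | inj₂ a₀<0 = inj₁ (zero , a₀<0)
  -- The recursion starts from `c` in place of `s`, because `c ≤ s + y₀ * a zero` for both values of
  -- `y₀`.
  ...   | inj₁ c-s<a₀ with some-negative⊎bounded-below (a ∘ suc) 0<c
  ...     | inj₁ (i , aᵢ<0)        = inj₁ (suc i , aᵢ<0)
  ...     | inj₂ (δ , 0<δ , bound) = inj₂ (δ , 0<δ , λ y y∈01 →
    ≤-trans (bound (y ∘ suc) (y∈01 ∘ suc))
      (≤-respʳ-≈ (+-assoc _ _ _) (+-mono-≤ (c≤s+y₀a₀ (y zero) (y∈01 zero)) ≤-refl)))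
    where
    c≤s+y₀a₀ : ∀ y₀ → y₀ ≈ 0# ⊎ y₀ ≈ 1# → c ≤ s + y₀ * a zero
    c≤s+y₀a₀ y₀ (inj₁ y₀≈0) =
      ≤-respʳ-≈ (sym (trans (+-congˡ (trans (*-congʳ y₀≈0) (zeroˡ _))) (+-identityʳ s))) (<⇒≤ c<s)
    c≤s+y₀a₀ y₀ (inj₂ y₀≈1) =
      ≤-respʳ-≈ (+-congˡ (sym (trans (*-congʳ y₀≈1) (*-identityˡ _))))
        (<⇒≤ (<-respˡ-≈ (solve 2 (λ c s → s :+ (c :- s) := c) refl c s) (+-monoʳ-< s c-s<a₀)))

-- Linear combinations and unit vectors.

module Combinations {c ℓ₁ ℓ₂} (ℝ : Reals c ℓ₁ ℓ₂) where
  open Reals ℝ hiding (zero)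
  open Polytopes ℝ
  open OrderedField ℝ
  open RingSolver commutativeRing
  open Algebra.Properties.Semiring.Sum (CommutativeRing.semiring commutativeRing)
    using (sum-cong-≋; ∑-distrib-+; ∑-comm; *-distribˡ-sum; *-distribʳ-sum; sum-replicate-zero)
  open import Relation.Binary.Reasoning.Setoid (CommutativeRing.setoid commutativeRing)

  private variable
    s s′ : Level
    d d′ k n : ℕ

  sum-*-+ : ∀ (w u v : Fin k → Carrier) →
            sum (λ j → w j * (u j + v j)) ≈ sum (λ j → w j * u j) + sum (λ j → w j * v j)
  sum-*-+ w u v =
    trans (sum-cong-≋ λ j → distribˡ (w j) (u j) (v j)) (∑-distrib-+ (λ j → w j * u j) (λ j → w j * v j))

  sum-*-scale : ∀ (w : Fin k → Carrier) α (u : Fin k → Carrier) →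
                sum (λ j → w j * (α * u j)) ≈ α * sum (λ j → w j * u j)
  sum-*-scale w α u =
    trans (sum-cong-≋ λ j → solve 3 (λ w α u → w :* (α :* u) := α :* (w :* u)) refl (w j) α (u j))
          (sym (*-distribˡ-sum α (λ j → w j * u j)))

  sum-*-const : ∀ (w : Fin k → Carrier) α → sum w ≈ 1# → sum (λ j → w j * α) ≈ α
  sum-*-const w α Σw≈1 = trans (sym (*-distribʳ-sum α w)) (trans (*-congʳ Σw≈1) (*-identityˡ α))

  -- Weights of sum 1 fix the base point `u`, so that only the parameters `η` are averaged.
  lincomb-line : ∀ (u b : ℝ^ d) (w η : Fin k → Carrier) → sum w ≈ 1# →
                 lincomb w (λ j → u ⊕ η j · b) ≋ (u ⊕ sum (λ j → w j * η j) · b)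
  lincomb-line u b w η Σw≈1 i = begin
    sum (λ j → w j * (u i + η j * b i))
      ≈⟨ sum-*-+ w (λ _ → u i) (λ j → η j * b i) ⟩
    sum (λ j → w j * u i) + sum (λ j → w j * (η j * b i))
      ≈⟨ +-cong (sum-*-const w (u i) Σw≈1) (sum-cong-≋ λ j → sym (*-assoc (w j) (η j) (b i))) ⟩
    u i + sum (λ j → w j * η j * b i)
      ≈⟨ +-congˡ (*-distribʳ-sum (b i) (λ j → w j * η j)) ⟨
    u i + sum (λ j → w j * η j) * b i                        ∎

  e-diag : ∀ (i : Fin d) → e i i ≈ 1#
  e-diag i with i ≟ i
  ... | yes _   = refl
  ... | no  i≢i = contradiction ≡.refl i≢i

  e-off : ∀ {i j : Fin d} → i ≢ j → e i j ≈ 0#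
  e-off {i = i} {j} i≢j with i ≟ j
  ... | yes i≡j = contradiction i≡j i≢j
  ... | no  _   = refl

  e-nonneg : ∀ (i j : Fin d) → 0# ≤ e i j
  e-nonneg i j with i ≟ j
  ... | yes _ = <⇒≤ 0<1
  ... | no  _ = ≤-refl

  e-sym : ∀ (i j : Fin d) → e i j ≈ e j i
  e-sym i j with i ≟ j
  ... | yes ≡.refl = sym (e-diag i)
  ... | no  i≢j    = sym (e-off (i≢j ∘ ≡.sym))

  sum-*-e : ∀ (a : Fin d → Carrier) i → sum (λ j → a j * e i j) ≈ a i
  sum-*-e {suc d} a zero = begin
    a zero * 1# + sum (λ j → a (suc j) * 0#)
      ≈⟨ +-cong (*-identityʳ _) (trans (sum-cong-≋ λ j → zeroʳ (a (suc j))) (sum-replicate-zero d)) ⟩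
    a zero + 0#                              ≈⟨ +-identityʳ _ ⟩
    a zero                                   ∎
  sum-*-e {suc d} a (suc i) = begin
    a zero * 0# + sum (λ j → a (suc j) * e i j) ≈⟨ +-cong (zeroʳ _) (sum-*-e (a ∘ suc) i) ⟩
    0# + a (suc i)                              ≈⟨ +-identityˡ _ ⟩
    a (suc i)                                   ∎

  sum-*-eᵀ : ∀ (a : Fin d → Carrier) i → sum (λ j → a j * e j i) ≈ a i
  sum-*-eᵀ a i = trans (sum-cong-≋ λ j → *-congˡ (e-sym j i)) (sum-*-e a i)

  -- Lowering `w j` to `v j` brings the total of `w` below that of `v`, so some entry of `v` exceeds
  -- the modified `w`. It is not the entry at `j`, where the two now agree.
  exchange : ∀ (v w : Fin k → Carrier) {j} → sum v ≈ sum w → v j < w j → ∃ λ i → j ≢ i × w i < v i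
  exchange v w {j} Σv≈Σw vⱼ<wⱼ = let i , uᵢ<vᵢ = sum-<⇒∃< Σu<Σv in i , compare i uᵢ<vᵢ
    where
    -- This is `w` with its entry at `j` replaced by `v j`.
    u = λ i → w i + (v j - w j) * e j i

    Σu<Σv : sum u < sum v
    Σu<Σv = <-respˡ-≈ (sym Σu≈) (<-respʳ-≈ (trans (+-identityʳ _) (sym Σv≈Σw))
              (+-monoʳ-< (sum w) (<-respʳ-≈ (-‿inverseʳ (w j)) (+-monoˡ-< (- w j) vⱼ<wⱼ))))
      where
      Σu≈ : sum u ≈ sum w + (v j - w j)
      Σu≈ = trans (∑-distrib-+ w (λ i → (v j - w j) * e j i)) (+-congˡ (sum-*-e (λ _ → v j - w j) j))

    compare : ∀ i → u i < v i → j ≢ i × w i < v i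
    compare i uᵢ<vᵢ with j ≟ i
    ... | yes ≡.refl = contradiction uᵢ<vᵢ (<-irrefl (solve 2 (λ w v → w :+ (v :- w) :* :1 := v) refl (w j) (v j)))
    ... | no  j≢i    = j≢i , <-respˡ-≈ (trans (+-congˡ (zeroʳ _)) (+-identityʳ (w i))) uᵢ<vᵢ

  -- Hulls and barycentric coordinates.

  lincomb-singleton : ∀ (x : ℝ^ d) → x ≋ lincomb {1} (λ _ → 1#) (λ _ → x)
  lincomb-singleton x i = solve 1 (λ x → x := :1 :* x :+ :0) refl (x i)

  ⊆-Aff : {S : Subset d s} → S ⊆ Aff S
  ⊆-Aff {x = x} x∈S = 1 , (λ _ → 1#) , (λ _ → x) , (λ _ → x∈S) , +-identityʳ 1# , lincomb-singleton x

  ⊆-Conv : {S : Subset d s} → S ⊆ Conv S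
  ⊆-Conv {x = x} x∈S =
    1 , (λ _ → 1#) , (λ _ → x) , (λ _ → x∈S) , (λ _ → <⇒≤ 0<1) , +-identityʳ 1# , lincomb-singleton x

  -- Barycentric coordinates with respect to the vertices `E` of the simplex; index `zero` belongs
  -- to the origin. Applied to `unit x`, the same formula gives coordinates on the cube.
  bary : ℝ^ n → Fin (suc n) → Carrier
  bary x zero    = 1# - sum x
  bary x (suc i) = x i

  bary-cong : ∀ {x y : ℝ^ n} → x ≋ y → ∀ l → bary x l ≈ bary y l
  bary-cong x≋y zero    = +-congˡ (-‿cong (sum-cong-≋ x≋y))
  bary-cong x≋y (suc i) = x≋y i

  sum-bary : ∀ (x : ℝ^ n) → sum (bary x) ≈ 1#
  sum-bary x = solve 1 (λ S → :1 :- S :+ S := :1) refl (sum x)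

  -- Affine interpolation in edge form: the value at the zeroth vertex plus the increments along the
  -- edges leaving it.
  sum-bary-* : ∀ (y : ℝ^ n) (a : Fin (suc n) → Carrier) →
               sum (λ i → bary y i * a i) ≈ a zero + sum (λ i → y i * (a (suc i) - a zero))
  sum-bary-* y a = sym (begin
    a zero + sum (λ i → y i * (a (suc i) - a zero))
      ≈⟨ +-congˡ (sum-*-+ y (a ∘ suc) (λ _ → - a zero)) ⟩
    a zero + (sum (λ i → y i * a (suc i)) + sum (λ i → y i * - a zero))
      ≈⟨ +-congˡ (+-congˡ (*-distribʳ-sum (- a zero) y)) ⟨
    a zero + (sum (λ i → y i * a (suc i)) + sum y * - a zero)
      ≈⟨ solve 3 (λ a₀ T S → a₀ :+ (T :+ S :* :- a₀) := (:1 :- S) :* a₀ :+ T) refl (a zero) (sum (λ i → y i * a (suc i))) (sum y) ⟩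
    sum (λ i → bary y i * a i)                                             ∎)

  -- At index `zero`, the constant in `1# - sum x` is preserved because the weights sum to 1.
  bary-lincomb : ∀ (w : Fin k → Carrier) (p : Fin k → ℝ^ n) {x} → sum w ≈ 1# → x ≋ lincomb w p →
                 ∀ l → bary x l ≈ sum (λ j → w j * bary (p j) l)
  bary-lincomb w p Σw≈1 x≋Σwp (suc i) = x≋Σwp i
  bary-lincomb w p {x} Σw≈1 x≋Σwp zero = sym (begin
    sum (λ j → w j * (1# - sum (p j)))
      ≈⟨ sum-*-+ w (λ _ → 1#) (λ j → - sum (p j)) ⟩
    sum (λ j → w j * 1#) + sum (λ j → w j * - sum (p j))
      ≈⟨ +-cong (sum-*-const w 1# Σw≈1)
                (sum-cong-≋ λ j → solve 2 (λ w S → w :* :- S := w :* (:- :1 :* S)) refl (w j) (sum (p j))) ⟩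
    1# + sum (λ j → w j * (- 1# * sum (p j)))
      ≈⟨ +-congˡ (trans (sum-*-scale w (- 1#) (sum ∘ p)) (solve 1 (λ T → :- :1 :* T := :- T) refl _)) ⟩
    1# - sum (λ j → w j * sum (p j))
      ≈⟨ +-congˡ (-‿cong (sum-cong-≋ λ j → *-distribˡ-sum (w j) (p j))) ⟩
    1# - sum (λ j → sum (λ i → w j * p j i))
      ≈⟨ +-congˡ (-‿cong (∑-comm λ j i → w j * p j i)) ⟩
    1# - sum (lincomb w p)                                     ≈⟨ bary-cong x≋Σwp zero ⟨
    1# - sum x                                                 ∎)

  E : Fin (suc n) → ℝ^ n
  E zero    = 𝟎
  E (suc i) = e i

  bary-E : ∀ (k l : Fin (suc n)) → bary (E k) l ≈ e k l
  bary-E {n} zero zero    = trans (+-congˡ (-‿cong (sum-replicate-zero n))) (solve 0 (:1 :- :0 := :1) refl)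
  bary-E zero    (suc l) = refl
  bary-E (suc k) zero    =
    trans (+-congˡ (-‿cong (trans (sum-cong-≋ λ j → sym (*-identityˡ (e k j))) (sum-*-e (λ _ → 1#) k))))
          (-‿inverseʳ 1#)
  bary-E (suc k) (suc l) = refl

  ≋-lincomb-E : ∀ (x : ℝ^ n) → x ≋ lincomb (bary x) E
  ≋-lincomb-E x l = sym (trans (+-cong (zeroʳ _) (sum-*-eᵀ x l)) (+-identityˡ (x l)))

  SimplexVertex : ℝ^ n → Set ℓ₁
  SimplexVertex x = x ≋ 𝟎 ⊎ ∃ λ i → x ≋ e i

  E-vertex : ∀ (k : Fin (suc n)) → SimplexVertex (E k)
  E-vertex zero    = inj₁ (λ _ → refl)
  E-vertex (suc i) = inj₂ (i , λ _ → refl)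

  -- Barycentric coordinates sum to 1 whatever their signs. Hence every vector is admissible as a
  -- value of a map into `Aff (△ n)`.
  ∈-Aff-△ : ∀ (x : ℝ^ n) → x ∈ Aff (△ n)
  ∈-Aff-△ {n} x =
    suc n , bary x , E , (λ k → ⊆-Conv {S = SimplexVertex} (E-vertex k)) , sum-bary x , ≋-lincomb-E x

  bary-nonneg⇒∈△ : ∀ {x : ℝ^ n} → (∀ l → 0# ≤ bary x l) → x ∈ △ n
  bary-nonneg⇒∈△ {n} {x} 0≤x = suc n , bary x , E , E-vertex , 0≤x , sum-bary x , ≋-lincomb-E x

  -- Each coordinate is affine, and its values at the vertices are entries of unit vectors.
  ∈△⇒bary-nonneg : ∀ {x : ℝ^ n} → x ∈ △ n → ∀ l → 0# ≤ bary x l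
  ∈△⇒bary-nonneg {n} (k , w , p , p∈ , 0≤w , Σw≈1 , x≋) l =
    ≤-respʳ-≈ (sym (bary-lincomb w p Σw≈1 x≋ l)) (sum-nonneg λ j → *-nonneg (0≤w j) (vertex-nonneg (p∈ j)))
    where
    E-nonneg : ∀ {y : ℝ^ n} m → y ≋ E m → 0# ≤ bary y l
    E-nonneg m y≋E = ≤-respʳ-≈ (sym (trans (bary-cong y≋E l) (bary-E m l))) (e-nonneg m l)

    vertex-nonneg : ∀ {y : ℝ^ n} → SimplexVertex y → 0# ≤ bary y l
    vertex-nonneg (inj₁ y≋𝟎)       = E-nonneg zero y≋𝟎
    vertex-nonneg (inj₂ (i , y≋e)) = E-nonneg (suc i) y≋e

  -- Some coordinate of an edge vector is 1 or -1; it is given with its inverse, by which `rank-1`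
  -- cancels to obtain linear independence.
  E-independent : ∀ {j k : Fin (suc n)} → j ≢ k → ∃₂ λ i r → (E k ⊖ E j) i * r ≈ 1#
  E-independent {j = j} {suc k} j≢k = k , 1# , (begin
    (e k k - E j k) * 1#
      ≈⟨ *-congʳ (+-cong (e-diag k) (-‿cong (trans (bary-E j (suc k)) (e-off j≢k)))) ⟩
    (1# - 0#) * 1#        ≈⟨ solve 0 ((:1 :- :0) :* :1 := :1) refl ⟩
    1#                    ∎)
  E-independent {j = suc j} {zero} j≢k = j , - 1# , (begin
    (0# - e j j) * - 1#   ≈⟨ *-congʳ (+-congˡ (-‿cong (e-diag j))) ⟩
    (0# - 1#) * - 1#      ≈⟨ solve 0 ((:0 :- :1) :* :- :1 := :1) refl ⟩
    1#                    ∎)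
  E-independent {j = zero} {zero} j≢k = contradiction ≡.refl j≢k

  -- Affine functions and affine maps.

  IsAffine : {A : Subset d s} → (Point A → Carrier) → Set _
  IsAffine {A = A} φ =
    ∀ {k} (w : Fin k → Carrier) (p : Fin k → Point A) (x : Point A) → sum w ≈ 1# →
    proj₁ x ≋ lincomb w (λ j → proj₁ (p j)) → φ x ≈ sum (λ j → w j * φ (p j))

  module _ {A : Subset d s} where

    const-affine : ∀ α → IsAffine {A = A} (λ _ → α)
    const-affine α w p x Σw≈1 x≋ = sym (sum-*-const w α Σw≈1)

    -- The relation between the four points is an affine combination with weights 1, 1 and -1.
    affine-parallelogram :
      {φ : Point A → Carrier} → IsAffine φ →
      ∀ x a b o → proj₁ x ≋ (proj₁ a ⊕ (proj₁ b ⊖ proj₁ o)) → φ x ≈ φ a + (φ b - φ o)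
    affine-parallelogram φ-affine x a b o x≋ = trans
      (φ-affine {3} (1# ∷ 1# ∷ - 1# ∷ []) (a ∷ b ∷ o ∷ []) x (solve 0 (:1 :+ (:1 :+ (:- :1 :+ :0)) := :1) refl)
         λ i → trans (x≋ i) (sym (combine (proj₁ a i) (proj₁ b i) (proj₁ o i))))
      (combine _ _ _)
      where
      combine : ∀ a b o → 1# * a + (1# * b + (- 1# * o + 0#)) ≈ a + (b - o)
      combine = solve 3 (λ a b o → :1 :* a :+ (:1 :* b :+ (:- :1 :* o :+ :0)) := a :+ (b :- o)) refl

    bary-affine : (F : AffineMap A (Aff (△ n))) → ∀ l → IsAffine (λ x → bary (F ⟨ x ⟩) l)
    bary-affine F l w p x Σw≈1 x≋ = bary-lincomb w (λ j → F ⟨ p j ⟩) Σw≈1 (AffineMap.affine F w p x Σw≈1 x≋) l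

    -- Both comparison maps have this form: with `b` zero it is the constant map to a vertex, with
    -- `b` an edge vector of the simplex it is the map onto that edge.
    line : (u b : ℝ^ n) {η : Point A → Carrier} → IsAffine η → AffineMap A (Aff (△ n))
    line u b {η} η-affine = record
      { to     = λ x → u ⊕ η x · b , ∈-Aff-△ _
      ; affine = λ w p x Σw≈1 x≋ i →
          trans (+-congˡ (*-congʳ (η-affine w p x Σw≈1 x≋))) (sym (lincomb-line u b w (η ∘ p) Σw≈1 i))
      }

    mix : Carrier → Carrier → (F G : AffineMap A (Aff (△ n))) → AffineMap A (Aff (△ n))
    mix α β F G = record
      { to     = λ x → α · F ⟨ x ⟩ ⊕ β · G ⟨ x ⟩ , ∈-Aff-△ _
      ; affine = λ w p x Σw≈1 x≋ i → sym (begin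
          sum (λ j → w j * (α * (F ⟨ p j ⟩) i + β * (G ⟨ p j ⟩) i))
            ≈⟨ sum-*-+ w (λ j → α * (F ⟨ p j ⟩) i) (λ j → β * (G ⟨ p j ⟩) i) ⟩
          sum (λ j → w j * (α * (F ⟨ p j ⟩) i)) + sum (λ j → w j * (β * (G ⟨ p j ⟩) i))
            ≈⟨ +-cong (sum-*-scale w α (λ j → (F ⟨ p j ⟩) i)) (sum-*-scale w β (λ j → (G ⟨ p j ⟩) i)) ⟩
          α * lincomb w (λ j → F ⟨ p j ⟩) i + β * lincomb w (λ j → G ⟨ p j ⟩) i
            ≈⟨ +-cong (*-congˡ (AffineMap.affine F w p x Σw≈1 x≋ i)) (*-congˡ (AffineMap.affine G w p x Σw≈1 x≋ i)) ⟨
          α * (F ⟨ x ⟩) i + β * (G ⟨ x ⟩) i ∎)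
      }

  bary-mix : ∀ {α β} (x y : ℝ^ n) → α + β ≈ 1# → ∀ l → bary (α · x ⊕ β · y) l ≈ α * bary x l + β * bary y l
  bary-mix {α = α} {β} x y α+β≈1 l = trans
    (bary-lincomb {k = 2} (α ∷ β ∷ []) (x ∷ y ∷ []) (trans (+-congˡ (+-identityʳ β)) α+β≈1)
      (λ i → +-congˡ (sym (+-identityʳ (β * y i)))) l)
    (+-congˡ (+-identityʳ _))

-- Corners and affine coordinates of the cube.

module CubeToSimplex {c ℓ₁ ℓ₂} (ℝ : Reals c ℓ₁ ℓ₂) where
  open Reals ℝ hiding (zero)
  open Polytopes ℝ
  open OrderedField ℝ
  open Combinations ℝ
  open RingSolver commutativeRing
  open Algebra.Properties.Semiring.Sum (CommutativeRing.semiring commutativeRing)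
    using (sum-cong-≋; sum-replicate-zero)
  open import Relation.Binary.Reasoning.Setoid (CommutativeRing.setoid commutativeRing)

  private variable
    m n : ℕ

  Corner : ℝ^ m → Set ℓ₁
  Corner a = ∀ i → a i ≈ 1# ⊎ a i ≈ - 1#

  -- Edges of the cube have length 2.
  step : Fin m → ℝ^ m
  step i = e i ⊕ e i

  base : ℝ^ m
  base _ = - 1#

  -- The corner `base` and its neighbours, used as an affine frame of the whole space.
  V : Fin (suc m) → ℝ^ m
  V zero    = base
  V (suc i) = base ⊕ step i

  step-up : ∀ {a : ℝ^ m} i → Corner a → a i ≈ - 1# → Corner (a ⊕ step i)
  step-up i a-corner aᵢ≈-1 l with i ≟ l
  ... | yes ≡.refl = inj₁ (trans (+-congʳ aᵢ≈-1) (solve 0 (:- :1 :+ (:1 :+ :1) := :1) refl))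
  ... | no  _      = Sum.map unmoved unmoved (a-corner l)
    where
    unmoved : ∀ {x y} → x ≈ y → x + (0# + 0#) ≈ y
    unmoved x≈y = trans (solve 1 (λ x → x :+ (:0 :+ :0) := x) refl _) x≈y

  step-down : ∀ {a : ℝ^ m} i → Corner a → a i ≈ 1# → Corner (a ⊖ step i)
  step-down i a-corner aᵢ≈1 l with i ≟ l
  ... | yes ≡.refl = inj₂ (trans (+-congʳ aᵢ≈1) (solve 0 (:1 :- (:1 :+ :1) := :- :1) refl))
  ... | no  _      = Sum.map unmoved unmoved (a-corner l)
    where
    unmoved : ∀ {x y} → x ≈ y → x - (0# + 0#) ≈ y
    unmoved x≈y = trans (solve 1 (λ x → x :- (:0 :+ :0) := x) refl _) x≈y

  V-corner : ∀ (i : Fin (suc m)) → Corner (V i)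
  V-corner zero    _ = inj₂ refl
  V-corner (suc i) = step-up i (λ _ → inj₂ refl) refl

  ½ : Carrier
  ½ = proj₁ half

  ½+½≈1 : ½ + ½ ≈ 1#
  ½+½≈1 = proj₂ (proj₂ half)

  -- Rescales each coordinate from [-1,1] to [0,1], so that `bary (unit x)` gives the coordinates of
  -- `x` in the frame `V`.
  unit : ℝ^ m → ℝ^ m
  unit x i = ½ * (1# + x i)

  unit-1 : ∀ {x : ℝ^ m} {i} → x i ≈ 1# → unit x i ≈ 1#
  unit-1 {x = x} {i} xᵢ≈1 = begin
    ½ * (1# + x i) ≈⟨ *-congˡ (+-congˡ xᵢ≈1) ⟩
    ½ * (1# + 1#)  ≈⟨ solve 1 (λ h → h :* (:1 :+ :1) := h :+ h) refl ½ ⟩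
    ½ + ½          ≈⟨ ½+½≈1 ⟩
    1#             ∎

  unit-0 : ∀ {x : ℝ^ m} {i} → x i ≈ - 1# → unit x i ≈ 0#
  unit-0 {x = x} {i} xᵢ≈-1 = begin
    ½ * (1# + x i)  ≈⟨ *-congˡ (+-congˡ xᵢ≈-1) ⟩
    ½ * (1# - 1#)   ≈⟨ solve 1 (λ h → h :* (:1 :- :1) := :0) refl ½ ⟩
    0#              ∎

  unit-affine : ∀ i → IsAffine {A = Aff (□ m)} (λ x → unit (proj₁ x) i)
  unit-affine i w p x Σw≈1 x≋ = begin
    ½ * (1# + proj₁ x i)
      ≈⟨ *-congˡ (+-cong (sym (sum-*-const w 1# Σw≈1)) (x≋ i)) ⟩
    ½ * (sum (λ j → w j * 1#) + sum (λ j → w j * proj₁ (p j) i))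
      ≈⟨ *-congˡ (sum-*-+ w (λ _ → 1#) (λ j → proj₁ (p j) i)) ⟨
    ½ * sum (λ j → w j * (1# + proj₁ (p j) i))
      ≈⟨ sum-*-scale w ½ (λ j → 1# + proj₁ (p j) i) ⟨
    sum (λ j → w j * (½ * (1# + proj₁ (p j) i)))                       ∎

  ≋-lincomb-V : ∀ (x : ℝ^ m) → x ≋ lincomb (bary (unit x)) V
  ≋-lincomb-V x l = sym (begin
    lincomb (bary y) V l                                        ≈⟨ sum-bary-* y (λ i → V i l) ⟩
    - 1# + sum (λ i → y i * (- 1# + (e i l + e i l) - - 1#))
      ≈⟨ +-congˡ (sum-cong-≋ λ i →
           solve 2 (λ y e → y :* (:- :1 :+ (e :+ e) :- :- :1) := (y :+ y) :* e) refl (y i) (e i l)) ⟩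
    - 1# + sum (λ i → (y i + y i) * e i l)
      ≈⟨ +-congˡ (sum-*-eᵀ (λ i → y i + y i) l) ⟩
    - 1# + (½ * (1# + x l) + ½ * (1# + x l))
      ≈⟨ solve 2 (λ h x → :- :1 :+ (h :* (:1 :+ x) :+ h :* (:1 :+ x))
                           := (h :+ h) :* (:1 :+ x) :- :1) refl ½ (x l) ⟩
    (½ + ½) * (1# + x l) - 1#                                   ≈⟨ +-congʳ (*-congʳ ½+½≈1) ⟩
    1# * (1# + x l) - 1#
      ≈⟨ solve 1 (λ x → :1 :* (:1 :+ x) :- :1 := x) refl (x l) ⟩
    x l                                                         ∎)
    where y = unit x

  corner∈□ : ∀ {a : ℝ^ m} → Corner a → a ∈ □ m
  corner∈□ = ⊆-Conv {S = Corner}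

  -- Opaque, lest the conversion checker compare these proofs.
  abstract
    ∈-Aff-□ : ∀ (x : ℝ^ m) → x ∈ Aff (□ m)
    ∈-Aff-□ {m} x = suc m , bary (unit x) , V , corner∈□ ∘ V-corner , sum-bary (unit x) , ≋-lincomb-V x

  at : ℝ^ m → Point (Aff (□ m))
  at x = x , ∈-Aff-□ x

  -- Moving a corner to the opposite facet changes φ by an amount that depends
  -- on the axis only, and φ is still nonnegative there.
  module _ {φ : Point (Aff (□ m)) → Carrier} (φ-affine : IsAffine φ)
           (0≤φ : ∀ a → Corner a → 0# ≤ φ (at a)) where

    decrease≤φ : ∀ {a} i → Corner a → a i ≈ - 1# → φ (at base) - φ (at (V (suc i))) ≤ φ (at a)
    decrease≤φ {a} i a-corner aᵢ≈-1 =
      x+p≈y⇒x≤y (0≤φ (a ⊕ step i) (step-up i a-corner aᵢ≈-1))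
        (trans (+-comm _ _) (sym (affine-parallelogram φ-affine (at a) (at (a ⊕ step i)) (at base) (at (V (suc i)))
          λ l → solve 2 (λ a e → a := (a :+ (e :+ e)) :+ (:- :1 :- (:- :1 :+ (e :+ e)))) refl (a l) (e i l))))

    increase≤φ : ∀ {a} i → Corner a → a i ≈ 1# → φ (at (V (suc i))) - φ (at base) ≤ φ (at a)
    increase≤φ {a} i a-corner aᵢ≈1 =
      x+p≈y⇒x≤y (0≤φ (a ⊖ step i) (step-down i a-corner aᵢ≈1))
        (trans (+-comm _ _) (sym (affine-parallelogram φ-affine (at a) (at (a ⊖ step i)) (at (V (suc i))) (at base)
          λ l → solve 2 (λ a e → a := (a :- (e :+ e)) :+ ((:- :1 :+ (e :+ e)) :- :- :1)) refl (a l) (e i l))))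

    -- In the frame `V`, the value of `φ` at a corner `a` is its value at `base` plus the edge
    -- differences at `base` weighted by the entries of `unit a`, each 0 or 1. This reduces the
    -- claim to `some-negative⊎bounded-below`.
    decreasing⊎bounded-below :
      0# < φ (at base) →
      (∃ λ i → φ (at (V (suc i))) < φ (at base)) ⊎
      (∃ λ δ → 0# < δ × (∀ a → Corner a → δ ≤ φ (at a)))
    decreasing⊎bounded-below 0<φ₀ = Sum.map
      (λ { (i , d<0) → i , decreasing d<0 })
      (λ { (δ , 0<δ , bound) → δ , 0<δ , λ a a-corner →
        ≤-respʳ-≈ (sym (trans (φ-affine (bary (unit a)) (at ∘ V) (at a) (sum-bary (unit a)) (≋-lincomb-V a))
                              (sum-bary-* (unit a) (φ ∘ at ∘ V))))
          (bound (unit a) λ i → [ inj₂ ∘ unit-1 {x = a} , inj₁ ∘ unit-0 {x = a} ]′ (a-corner i)) })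
      (some-negative⊎bounded-below (λ i → φ (at (V (suc i))) - φ (at base)) 0<φ₀)
      where
      decreasing : ∀ {x y} → x - y < 0# → x < y
      decreasing {x} {y} lt = 
        <-respˡ-≈ (solve 2 (λ x y → x :- y :+ y := x) refl x y) (<-respʳ-≈ (+-identityˡ y) (+-monoˡ-< y lt))

  -- The barycentric coordinates of `F` are affine, so their signs at the corners carry over to
  -- convex combinations.
  corners-nonneg⇒Hom :
    (F : AffineMap (Aff (□ m)) (Aff (△ n))) →
    (∀ a → Corner a → ∀ l → 0# ≤ bary (F ⟨ at a ⟩) l) → F ∈ Hom (□ m) (△ n)
  corners-nonneg⇒Hom F 0≤F x (k , w , p , p-corner , 0≤w , Σw≈1 , x≋) = bary-nonneg⇒∈△ λ l →
    ≤-respʳ-≈ (sym (bary-affine F l w (at ∘ p) x Σw≈1 x≋))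
      (sum-nonneg λ j → *-nonneg (0≤w j) (0≤F (p j) (p-corner j) l))

  Hom⇒corners-nonneg :
    (F : AffineMap (Aff (□ m)) (Aff (△ n))) → F ∈ Hom (□ m) (△ n) →
    ∀ a → Corner a → ∀ l → 0# ≤ bary (F ⟨ at a ⟩) l
  Hom⇒corners-nonneg F F∈Hom a a-corner = ∈△⇒bary-nonneg (F∈Hom (at a) (corner∈□ a-corner))

  -- If f dominates s g coordinatewise, then f lies in the interior of a segment
  -- of Hom starting at g.
  vertex-dominating :
    (f g : AffineMap (Aff (□ m)) (Aff (△ n))) → f ∈ vert (□ m) (△ n) → ∀ {s} → 0# < s →
    (∀ a → Corner a → ∃ λ k → g ⟨ at a ⟩ ≋ E k × s ≤ bary (f ⟨ at a ⟩) k) →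
    ∀ x → f ⟨ x ⟩ ≋ g ⟨ x ⟩
  vertex-dominating {m} {n} f g (f∈Hom , extreme) {s} 0<s dominates =
    -- The bound `t < s` keeps `f` minus `t` times `g` nonnegative at the corners; `t < 1#` allows
    -- rescaling it by the inverse `r` of `1# - t`.
    let t , 0<t , t<s , t<1 = positive-below₂ 0<s 0<1
        r , [1-t]r≈1 , 0<r = positive⇒invertible (x<y⇒0<y-x t<1)
    in conclude t r 0<t t<s t<1 [1-t]r≈1 0<r
    where
    module _ (t r : Carrier) (0<t : 0# < t) (t<s : t < s) (t<1 : t < 1#)
             ([1-t]r≈1 : (1# - t) * r ≈ 1#) (0<r : 0# < r) where

      h : AffineMap (Aff (□ m)) (Aff (△ n))
      -- This is (f - t g) / (1 - t), since `1# - r` equals `- (r * t)`.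
      h = mix r (1# - r) f g

      1-r≈-rt : 1# - r ≈ - (r * t)
      1-r≈-rt = trans (+-congʳ (sym [1-t]r≈1)) (solve 2 (λ t r → (:1 :- t) :* r :- r := :- (r :* t)) refl t r)

      bary-h : ∀ x l → bary (h ⟨ x ⟩) l ≈ r * (bary (f ⟨ x ⟩) l - t * bary (g ⟨ x ⟩) l)
      bary-h x l = begin
        bary (h ⟨ x ⟩) l
          ≈⟨ bary-mix (f ⟨ x ⟩) (g ⟨ x ⟩) (solve 1 (λ r → r :+ (:1 :- r) := :1) refl r) l ⟩
        r * bary (f ⟨ x ⟩) l + (1# - r) * bary (g ⟨ x ⟩) l         ≈⟨ +-congˡ (*-congʳ 1-r≈-rt) ⟩
        r * bary (f ⟨ x ⟩) l + - (r * t) * bary (g ⟨ x ⟩) l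
          ≈⟨ solve 4 (λ r t F G → r :* F :+ :- (r :* t) :* G := r :* (F :- t :* G)) refl r t _ _ ⟩
        r * (bary (f ⟨ x ⟩) l - t * bary (g ⟨ x ⟩) l)              ∎

      -- At index `k` the bound `s` exceeds `t`; at every other index the left side is 0 and `f` is
      -- nonnegative.
      t*E≤f : ∀ a → Corner a → ∀ k l → s ≤ bary (f ⟨ at a ⟩) k → t * e k l ≤ bary (f ⟨ at a ⟩) l
      t*E≤f a a-corner k l s≤f with k ≟ l
      ... | yes ≡.refl = ≤-respˡ-≈ (sym (*-identityʳ t)) (≤-trans (<⇒≤ t<s) s≤f)
      ... | no  _      = ≤-respˡ-≈ (sym (zeroʳ t)) (Hom⇒corners-nonneg f f∈Hom a a-corner l)

      0≤h : ∀ a → Corner a → ∀ l → 0# ≤ bary (h ⟨ at a ⟩) l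
      0≤h a a-corner l =
        let k , g≋E , s≤f = dominates a a-corner
        in ≤-respʳ-≈ (sym (bary-h (at a) l)) (*-nonneg (<⇒≤ 0<r) (x≤y⇒0≤y-x
             (≤-respˡ-≈ (*-congˡ (sym (trans (bary-cong g≋E l) (bary-E k l)))) (t*E≤f a a-corner k l s≤f))))

      g∈Hom : g ∈ Hom (□ m) (△ n)
      g∈Hom = corners-nonneg⇒Hom g λ a a-corner l →
        let k , g≋E , _ = dominates a a-corner
        in ≤-respʳ-≈ (sym (trans (bary-cong g≋E l) (bary-E k l))) (e-nonneg k l)

      f≋mix : ∀ x → f ⟨ x ⟩ ≋ (1# - t) · h ⟨ x ⟩ ⊕ t · g ⟨ x ⟩
      f≋mix x i = sym (begin
        (1# - t) * (r * F + (1# - r) * G) + t * G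
          ≈⟨ solve 4 (λ t r F G → (:1 :- t) :* (r :* F :+ (:1 :- r) :* G) :+ t :* G
                               := (:1 :- t) :* r :* (F :- G) :+ G) refl t r F G ⟩
        (1# - t) * r * (F - G) + G
          ≈⟨ +-congʳ (*-congʳ [1-t]r≈1) ⟩
        1# * (F - G) + G
          ≈⟨ solve 2 (λ F G → :1 :* (F :- G) :+ G := F) refl F G ⟩
        F ∎)
        where F = (f ⟨ x ⟩) i ; G = (g ⟨ x ⟩) i

      conclude : ∀ x → f ⟨ x ⟩ ≋ g ⟨ x ⟩
      conclude x i = begin
        (f ⟨ x ⟩) i                                    ≈⟨ f≋mix x i ⟩
        (1# - t) * (h ⟨ x ⟩) i + t * (g ⟨ x ⟩) i
          -- Extremality identifies `h` with `g`, so the combination collapses to `g`.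
          ≈⟨ +-congʳ (*-congˡ (extreme h g t (corners-nonneg⇒Hom h 0≤h) g∈Hom 0<t t<1 f≋mix x i)) ⟩
        (1# - t) * (g ⟨ x ⟩) i + t * (g ⟨ x ⟩) i
          ≈⟨ solve 2 (λ t G → (:1 :- t) :* G :+ t :* G := G) refl t ((g ⟨ x ⟩) i) ⟩
        (g ⟨ x ⟩) i                                    ∎

  -- The rank of a map whose image lies on a line.

  module _ {f : AffineMap (Aff (□ m)) (Aff (△ n))} {u b : ℝ^ n} {η : Point (Aff (□ m)) → Carrier}
           (f≋ : ∀ x → f ⟨ x ⟩ ≋ (u ⊕ η x · b)) where

    private
      span : Subset n _
      span = Aff (Image (□ m) (△ n) f)

    ∈-span : ∀ a → Corner a → f ⟨ at a ⟩ ∈ span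
    ∈-span a a-corner = ⊆-Aff {S = Image (□ m) (△ n) f} (at a , corner∈□ a-corner , λ _ → refl)

    span⊆line : ∀ {z} → z ∈ span → ∃ λ τ → z ≋ (u ⊕ τ · b)
    span⊆line {z} (k , w , p , p∈ , Σw≈1 , z≋) = sum (λ j → w j * η (x j)) , λ i → begin
      z i                                        ≈⟨ z≋ i ⟩
      lincomb w p i
        ≈⟨ sum-cong-≋ (λ j → *-congˡ (trans (proj₂ (proj₂ (p∈ j)) i) (f≋ (x j) i))) ⟩
      lincomb w (λ j → u ⊕ η (x j) · b) i        ≈⟨ lincomb-line u b w (η ∘ x) Σw≈1 i ⟩
      u i + sum (λ j → w j * η (x j)) * b i      ∎
      where x = λ j → proj₁ (p∈ j)

    Direction-span : ∀ {v} → v ∈ Direction span → ∃ λ τ → v ≋ (τ · b)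
    Direction-span (x , y , x∈ , y∈ , v≋) =
      let τ , x≋ = span⊆line x∈
          τ′ , y≋ = span⊆line y∈
      in τ - τ′ , λ i → trans (v≋ i) (trans (+-cong (x≋ i) (-‿cong (y≋ i)))
           (solve 4 (λ u b τ τ′ → u :+ τ :* b :- (u :+ τ′ :* b) := (τ :- τ′) :* b) refl (u i) (b i) τ τ′))

    -- All directions are multiples of the zero vector, so the empty family is a basis.
    rank-0 : b ≋ 𝟎 → HasRank (□ m) (△ n) 0 f
    rank-0 b≋𝟎 =
      (f ⟨ at base ⟩ , ∈-span base (V-corner zero)) , (λ ()) , (λ ()) , (λ _ _ ()) , λ v v∈ →
        (λ ()) , λ i → let τ , v≋ = Direction-span v∈ in trans (v≋ i) (trans (*-congˡ (b≋𝟎 i)) (zeroʳ τ))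

    -- The vector `b` is the difference of the values of `f` at `a` and `a′`, hence a direction; its
    -- invertible coordinate makes it independent.
    rank-1 : ∀ {a a′} → Corner a → Corner a′ → η (at a) ≈ 1# → η (at a′) ≈ 0# →
             (∃₂ λ i r → b i * r ≈ 1#) → HasRank (□ m) (△ n) 1 f
    rank-1 {a} {a′} a-corner a′-corner ηa≈1 ηa′≈0 (i , r , bᵢr≈1) =
      (f ⟨ at a ⟩ , ∈-span a a-corner) ,
      (λ _ → b) ,
      (λ _ → f ⟨ at a ⟩ , f ⟨ at a′ ⟩ , ∈-span a a-corner , ∈-span a′ a′-corner , b≋) ,
      independent ,
      λ v v∈ → let τ , v≋ = Direction-span v∈ in (λ _ → τ) , λ l → trans (v≋ l) (sym (+-identityʳ _))
      where
      b≋ : b ≋ ((f ⟨ at a ⟩) ⊖ (f ⟨ at a′ ⟩))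
      b≋ l = sym (begin
        (f ⟨ at a ⟩) l - (f ⟨ at a′ ⟩) l
          ≈⟨ +-cong (f≋ (at a) l) (-‿cong (f≋ (at a′) l)) ⟩
        u l + η (at a) * b l - (u l + η (at a′) * b l)
          ≈⟨ +-cong (+-congˡ (*-congʳ ηa≈1)) (-‿cong (+-congˡ (*-congʳ ηa′≈0))) ⟩
        u l + 1# * b l - (u l + 0# * b l)
          ≈⟨ solve 2 (λ u b → u :+ :1 :* b :- (u :+ :0 :* b) := b) refl (u l) (b l) ⟩
        b l                                                  ∎)

      independent : LinearlyIndependent {1} (λ _ → b)
      independent w wb≋𝟎 zero = begin
        w zero                            ≈⟨ *-identityʳ _ ⟨
        w zero * 1#                       ≈⟨ *-congˡ bᵢr≈1 ⟨
        w zero * (b i * r)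
          ≈⟨ solve 3 (λ w b r → w :* (b :* r) := (w :* b :+ :0) :* r) refl (w zero) (b i) r ⟩
        (w zero * b i + 0#) * r           ≈⟨ *-congʳ (wb≋𝟎 i) ⟩
        0# * r                            ≈⟨ zeroˡ r ⟩
        0#                                ∎

  -- The rank of a vertex map.

  vertex-rank : (f : AffineMap (Aff (□ m)) (Aff (△ n))) → f ∈ vert (□ m) (△ n) →
                HasRank (□ m) (△ n) 0 f ⊎ HasRank (□ m) (△ n) 1 f
  vertex-rank {m} {n} f f∈vert = from-positive (sum-<⇒∃< Σ0<Σψ)
    where
    ψ : Fin (suc n) → Point (Aff (□ m)) → Carrier
    ψ l x = bary (f ⟨ x ⟩) l

    ψ-affine : ∀ l → IsAffine (ψ l)
    ψ-affine = bary-affine f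

    0≤ψ : ∀ l a → Corner a → 0# ≤ ψ l (at a)
    0≤ψ l a a-corner = Hom⇒corners-nonneg f (proj₁ f∈vert) a a-corner l

    -- The coordinates at `base` sum to 1, so comparison with the zero family singles out a positive
    -- one.
    Σ0<Σψ : sum {suc n} (λ _ → 0#) < sum (λ l → ψ l (at base))
    Σ0<Σψ = <-respˡ-≈ (sym (sum-replicate-zero (suc n))) (<-respʳ-≈ (sym (sum-bary (f ⟨ at base ⟩))) 0<1)

    along-edge : ∀ {i j k} → j ≢ k →
                 ψ j (at (V (suc i))) < ψ j (at base) → ψ k (at base) < ψ k (at (V (suc i))) →
                 HasRank (□ m) (△ n) 1 f
    along-edge {i} {j} {k} j≢k falls rises =
      -- One bound below both the fall of `ψ j` and the rise of `ψ k` serves the two opposite facets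
      -- together.
      let s , 0<s , s<fall , s<rise = positive-below₂ (x<y⇒0<y-x falls) (x<y⇒0<y-x rises)
      -- The values of `g` unfold to the form `u ⊕ η x · b`, so the equality of `f` and `g` is the
      -- hypothesis on `f` in `rank-1`.
      in rank-1 {f = f} (vertex-dominating f g f∈vert 0<s (dominates (<⇒≤ s<fall) (<⇒≤ s<rise)))
           (V-corner (suc i)) (V-corner zero) (unit-1 {x = V (suc i)} Vᵢ≈1) (unit-0 {x = base} {i} refl)
           (E-independent j≢k)
      where
      g : AffineMap (Aff (□ m)) (Aff (△ n))
      g = line (E j) (E k ⊖ E j) (unit-affine i)

      Vᵢ≈1 : V (suc i) i ≈ 1#
      Vᵢ≈1 = trans (+-congˡ (+-cong (e-diag i) (e-diag i))) (solve 0 (:- :1 :+ (:1 :+ :1) := :1) refl)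

      dominates : ∀ {s} → s ≤ ψ j (at base) - ψ j (at (V (suc i))) →
                  s ≤ ψ k (at (V (suc i))) - ψ k (at base) →
                  ∀ a → Corner a → ∃ λ l → g ⟨ at a ⟩ ≋ E l × s ≤ ψ l (at a)
      -- On the facet where `a i` is 1, `g` takes the value `E k` and `ψ k` is at least its rise; on
      -- the opposite facet, `g` takes the value `E j` and `ψ j` is at least its fall.
      dominates s≤fall s≤rise a a-corner = [
          (λ aᵢ≈1 → k
            , (λ l → trans (+-congˡ (*-congʳ (unit-1 {x = a} aᵢ≈1)))
                           (solve 2 (λ u v → u :+ :1 :* (v :- u) := v) refl (E j l) (E k l)))
            , ≤-trans s≤rise (increase≤φ (ψ-affine k) (0≤ψ k) i a-corner aᵢ≈1))
        , (λ aᵢ≈-1 → j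
            , (λ l → trans (+-congˡ (*-congʳ (unit-0 {x = a} aᵢ≈-1)))
                           (solve 2 (λ u v → u :+ :0 :* (v :- u) := u) refl (E j l) (E k l)))
            , ≤-trans s≤fall (decrease≤φ (ψ-affine j) (0≤ψ j) i a-corner aᵢ≈-1))
        ]′ (a-corner i)

    from-positive : (∃ λ j → 0# < ψ j (at base)) → HasRank (□ m) (△ n) 0 f ⊎ HasRank (□ m) (△ n) 1 f
    from-positive (j , 0<ψⱼ) = [
        (λ { (i , falls) →
          -- The coordinates sum to 1 at both ends of the edge, so the fall of one is made up by the
          -- rise of another.
          let k , j≢k , rises =
                exchange (λ l → ψ l (at (V (suc i)))) (λ l → ψ l (at base)) {j}
                  (trans (sum-bary (f ⟨ at (V (suc i)) ⟩)) (sym (sum-bary (f ⟨ at base ⟩)))) falls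
          in inj₂ (along-edge {i} {j} {k} j≢k falls rises) })
      , (λ { (δ , 0<δ , δ≤ψⱼ) →
          -- The constant map to `E j` is written as a line with zero direction vector.
          inj₁ (rank-0 {f = f} (vertex-dominating f (line (E j) 𝟎 (const-affine 0#)) f∈vert 0<δ λ a a-corner →
            j , (λ l → solve 1 (λ u → u :+ :0 :* :0 := u) refl (E j l)) , δ≤ψⱼ a a-corner) (λ _ → refl)) })
      ]′ (decreasing⊎bounded-below (ψ-affine j) (0≤ψ j) 0<ψⱼ)

theorem4p1 : ∀ {c ℓ₁ ℓ₂} (ℝ : Reals c ℓ₁ ℓ₂) → let open Polytopes ℝ in
    (m n : ℕ) →
    vert (□ m) (△ n) ≐ (vert⁽_⁾ (□ m) (△ n) 0 ∪ vert⁽_⁾ (□ m) (△ n) 1)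
theorem4p1 ℝ m n =
  (λ {f} f∈vert → Sum.map (f∈vert ,_) (f∈vert ,_) (CubeToSimplex.vertex-rank ℝ f f∈vert)) ,
  [ proj₁ , proj₁ ]′
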